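{- For every constant $\varepsilon>0$, no data stream algorithm for maximizing a non-negative submodular function subject to a cardinality constraint is $(2-\varepsilon)$-competitive, unless it uses $\Omega(|N|)$ memory.
   Context: Problem: given a finite ground set $N$, a non-negative submodular function $f\colon 2^N\to\mathbb{R}_{\ge 0}$ (accessed through a value oracle) and a positive integer $k$, find $S\subseteq N$ with $|S|\le k$ maximizing $f(S)$; $OPT$ denotes an optimal solution. In the data stream model the elements of $N$ arrive one at a time in an arbitrary (adversarial) order and are processed in a single pass with the stated memory; the algorithm may use unbounded computation. An algorithm is $\beta$-competitive if its output $S$ is feasible and $\mathbb{E}[f(S)]\ge f(OPT)/\beta$ on every input. -}

module Defs where

open import Level using (0ℓ)
open import Algebra.Bundles using (CommutativeRing)
open import Data.Nat as ℕ using (ℕ; _⊔_)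
open import Data.Fin using (Fin)
open import Data.Fin.Subset using (Subset; _∪_; _∩_; _⊆_; ⊥; ⁅_⁆; ∣_∣)
open import Data.List using (List; []; _∷_; allFin)
open import Data.List.Relation.Binary.Permutation.Propositional using (_↭_)
open import Data.Product using (Σ; ∃; _×_; _,_; proj₁; proj₂)
open import Relation.Binary using (Rel; IsTotalOrder)
open import Relation.Binary.PropositionalEquality using (_≡_)
open import Relation.Nullary using (¬_)
import Algebra.Definitions.RawMonoid as RawMonoidDefs
import Relation.Binary.Construct.NonStrictToStrict as ToStrict

-- Stands in for ℝ, which the library lacks. Classically ℝ is an instance;
-- order completeness is not required, so ℚ is one too.
record ArchimedeanOrderedField : Set₁ where
  field
    commutativeRing : CommutativeRing 0ℓ 0ℓ
  open CommutativeRing commutativeRing public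
  open RawMonoidDefs +-rawMonoid public using () renaming (_×_ to _·_)

  fromℕ : ℕ → Carrier
  fromℕ n = n · 1#

  infix 4 _≤_
  field
    _≤_          : Rel Carrier 0ℓ
    isTotalOrder : IsTotalOrder _≈_ _≤_
    +-monoʳ-≤    : ∀ x {y z} → y ≤ z → x + y ≤ x + z
    *-nonneg     : ∀ {x y} → 0# ≤ x → 0# ≤ y → 0# ≤ x * y
    0≉1          : ¬ (0# ≈ 1#)
    inverse      : ∀ x → ¬ (x ≈ 0#) → ∃ λ y → x * y ≈ 1#
    archimedean  : ∀ x → ∃ λ n → x ≤ fromℕ n

  open ToStrict _≈_ _≤_ public using (_<_)

module Streaming (ℝ : ArchimedeanOrderedField) where
  open ArchimedeanOrderedField ℝ

  SetFunction : ℕ → Set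
  SetFunction n = Subset n → Carrier

  NonNegative : ∀ {n} → SetFunction n → Set
  NonNegative f = ∀ S → 0# ≤ f S

  Submodular : ∀ {n} → SetFunction n → Set
  Submodular f = ∀ S T → f (S ∪ T) + f (S ∩ T) ≤ f S + f T

  IsOptimal : ∀ {n} → SetFunction n → ℕ → Subset n → Set
  IsOptimal f k O = ∣ O ∣ ℕ.≤ k × (∀ S → ∣ S ∣ ℕ.≤ k → f S ≤ f O)

  -- A probability space presented by its expectation functional, so that
  -- algorithms are not limited to finite randomness. Every probability space,
  -- with its integrable real random variables, is an instance; countable
  -- additivity is not required.
  record ProbabilitySpace : Set₁ where
    field
      Outcome    : Set
      Integrable : (Outcome → Carrier) → Set
      𝔼          : ∀ {X} → Integrable X → Carrier
      int-const  : ∀ c → Integrable (λ _ → c)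
      int-+      : ∀ {X Y} → Integrable X → Integrable Y → Integrable (λ ω → X ω + Y ω)
      int-*      : ∀ c {X} → Integrable X → Integrable (λ ω → c * X ω)
      𝔼-const    : ∀ c (i : Integrable (λ _ → c)) → 𝔼 i ≈ c
      𝔼-+        : ∀ {X Y} (i : Integrable X) (j : Integrable Y) → 𝔼 (int-+ i j) ≈ 𝔼 i + 𝔼 j
      𝔼-*        : ∀ c {X} (i : Integrable X) → 𝔼 (int-* c i) ≈ c * 𝔼 i
      𝔼-mono     : ∀ {X Y} (i : Integrable X) (j : Integrable Y) → (∀ ω → X ω ≤ Y ω) → 𝔼 i ≤ 𝔼 j

  -- A computation that may adaptively ask the value oracle for f T, but only
  -- for sets T of available elements.
  data OracleComp {n} (available : Subset n) (A : Set) : Set where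
    return : A → OracleComp available A
    query  : (T : Subset n) → T ⊆ available → (Carrier → OracleComp available A) →
             OracleComp available A

  answer : ∀ {n} {M : Subset n} {A : Set} → SetFunction n → OracleComp M A → A
  answer f (return a)      = a
  answer f (query T _ cont) = answer f (cont (f T))

  -- A state holds a set of stream elements together with arbitrary further
  -- information. Elements not kept are lost: they can be neither queried nor
  -- output later. The random outcome ω is available throughout at no cost.
  -- `space` is any accounting of memory that charges at least one unit per
  -- element held.
  record AlgorithmFor (n k : ℕ) : Set₁ where
    field
      randomness : ProbabilitySpace
    open ProbabilitySpace randomness public
    field
      State        : Set
      stored       : State → Subset n
      space        : State → ℕ
      stored≤space : ∀ s → ∣ stored s ∣ ℕ.≤ space s
      init         : State
      init-empty   : stored init ≡ ⊥
      step         : Outcome → (s : State) (e : Fin n) →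
                     OracleComp (stored s ∪ ⁅ e ⁆) (Σ State λ s′ → stored s′ ⊆ stored s ∪ ⁅ e ⁆)
      finish       : Outcome → (s : State) →
                     OracleComp (stored s) (Σ (Subset n) λ S → S ⊆ stored s)

    next : SetFunction n → Outcome → State → Fin n → State
    next f ω s e = proj₁ (answer f (step ω s e))

    outputFrom : SetFunction n → Outcome → State → List (Fin n) → Subset n
    outputFrom f ω s []       = proj₁ (answer f (finish ω s))
    outputFrom f ω s (e ∷ es) = outputFrom f ω (next f ω s e) es

    peakFrom : SetFunction n → Outcome → State → List (Fin n) → ℕ
    peakFrom f ω s []       = space s
    peakFrom f ω s (e ∷ es) = space s ⊔ peakFrom f ω (next f ω s e) es

    output : SetFunction n → List (Fin n) → Outcome → Subset n
    output f stream ω = outputFrom f ω init stream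

    peakSpace : SetFunction n → List (Fin n) → Outcome → ℕ
    peakSpace f stream ω = peakFrom f ω init stream

  -- The algorithm may know both |N| and k in advance.
  StreamingAlgorithm : Set₁
  StreamingAlgorithm = (n k : ℕ) → AlgorithmFor n k

  record Input (n k : ℕ) : Set where
    field
      k-positive  : 1 ℕ.≤ k
      f           : SetFunction n
      nonNegative : NonNegative f
      submodular  : Submodular f
      stream      : List (Fin n)
      arrivesOnce : stream ↭ allFin n

  -- 𝔼[f(S)] ≥ f(OPT)/β is multiplied out, so that β ≤ 0 (for which dividing
  -- is meaningless or reverses the inequality) cannot make it hold vacuously.
  CompetitiveOn : ∀ {n k} → Carrier → AlgorithmFor n k → Input n k → Set
  CompetitiveOn {n} {k} β A I =
    (∀ ω → ∣ output f stream ω ∣ ℕ.≤ k) ×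
    Σ (Integrable (λ ω → f (output f stream ω))) λ i →
      ∀ OPT → IsOptimal f k OPT → f OPT ≤ β * 𝔼 i
    where open AlgorithmFor A; open Input I

  Competitive : Carrier → StreamingAlgorithm → Set
  Competitive β A = ∀ n k (I : Input n k) → CompetitiveOn β (A n k) I

  UsesMemoryAtMost : StreamingAlgorithm → (ℕ → ℕ → ℕ) → Set
  UsesMemoryAtMost A m = ∀ n k (I : Input n k) ω →
    AlgorithmFor.peakSpace (A n k) (Input.f I) (Input.stream I) ω ℕ.≤ m n k

{-# OPTIONS --safe #-}

-- Fix K with εK ≥ 3 and put k = K + 1. A special element w arrives last, and a
-- K-element set O is hidden among the others: f(S) = |S| if w ∉ S, and
-- f(S) = K + |S ∩ O| if w ∈ S. The optimum is O ∪ {w}, of value 2K. Until w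
-- arrives the oracle reveals nothing about O, so the set M held at that moment
-- does not depend on O, and the output has value at most K + 1 + |M ∩ O|. Summing
-- over ⌊(n - 1)/K⌋ disjoint choices of O bounds the total value of the outputs by
-- ⌊(n - 1)/K⌋(K + 1) + |M|, whereas competitiveness forces each expectation to
-- exceed K + 1 by a constant; hence |M| is linear in n.
module Submission where

open import Defs
open import Data.Nat as ℕ using (ℕ)
open import Data.Product using (Σ; ∃; _×_)

open import Data.Fin using (Fin; zero; suc)
open import Data.Fin.Subset using (Subset; inside; outside; _∉_; _⊆_; _∪_; _∩_; ⊥; ⁅_⁆; ∣_∣)
open import Data.Fin.Subset.Properties using
  ( ∉⊥; ∣⊥∣≡0; ∣p∣≤∣x∷p∣; drop-∷-⊆; p⊆q⇒∣p∣≤∣q∣; x∈⁅y⁆⇒x≡y; x∈p∪q⁻; x∈p∩q⁺; x∈p∩q⁻; p∩q⊆p; p∩q⊆q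
  ; ∣p∩q∣≤∣q∣; ∪-comm; ∪-identityʳ; ∩-comm; ∩-idem; ∩-zeroʳ; ∩-distribʳ-∪)
open import Data.List using (List; []; _∷_; _++_; allFin; foldl; length; map)
open import Data.List.Properties using (length-map; map-tabulate)
open import Data.List.Relation.Binary.Permutation.Propositional using (_↭_; ↭-trans; ↭-reflexive; ↭-sym)
open import Data.List.Relation.Binary.Permutation.Propositional.Properties using (∷↭∷ʳ)
open import Data.List.Relation.Unary.All using (All; []; _∷_; universal) renaming (map to All-map)
import Data.List.Relation.Unary.All.Properties as All
open import Data.Nat using (s≤s; z≤n)
open import Data.Nat.DivMod using (_/_; _%_; m≡m%n+[m/n]*n; m%n<n; m≥n⇒m/n>0)
import Data.Nat.ListAction as ℕ
import Data.Nat.Properties as ℕ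
import Data.Nat.Tactic.RingSolver as ℕ-Solver
open import Data.Product using (_,_; proj₁; proj₂)
open import Data.Sum using (_⊎_; inj₁; inj₂; [_,_]′)
open import Data.Vec using (_∷_; []; tail; here)
open import Function using (_∘_; id)
open import Relation.Binary using (IsTotalOrder; Poset)
open import Relation.Binary.PropositionalEquality as ≡ using (_≡_; _≢_; refl; cong; subst)
open import Relation.Nullary using (¬_; contradiction)
import Algebra.Properties.CommutativeSemigroup as *-Properties
import Algebra.Properties.Monoid.Mult as Mult
import Algebra.Properties.Ring as RingProperties
import Algebra.Properties.Semiring.Mult as SemiringMult
import Relation.Binary.Reasoning.PartialOrder as PosetReasoning

private
  variable
    n : ℕ

-- Cardinalities of finite subsets

∣p∪q∣+∣p∩q∣≡∣p∣+∣q∣ : (p q : Subset n) → ∣ p ∪ q ∣ ℕ.+ ∣ p ∩ q ∣ ≡ ∣ p ∣ ℕ.+ ∣ q ∣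
∣p∪q∣+∣p∩q∣≡∣p∣+∣q∣ []            []            = refl
∣p∪q∣+∣p∩q∣≡∣p∣+∣q∣ (outside ∷ p) (outside ∷ q) = ∣p∪q∣+∣p∩q∣≡∣p∣+∣q∣ p q
∣p∪q∣+∣p∩q∣≡∣p∣+∣q∣ (inside ∷ p)  (outside ∷ q) = cong ℕ.suc (∣p∪q∣+∣p∩q∣≡∣p∣+∣q∣ p q)
∣p∪q∣+∣p∩q∣≡∣p∣+∣q∣ (outside ∷ p) (inside ∷ q)  =
  ≡.trans (cong ℕ.suc (∣p∪q∣+∣p∩q∣≡∣p∣+∣q∣ p q)) (≡.sym (ℕ.+-suc ∣ p ∣ ∣ q ∣))
∣p∪q∣+∣p∩q∣≡∣p∣+∣q∣ (inside ∷ p)  (inside ∷ q)  = cong ℕ.suc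
  (≡.trans (ℕ.+-suc ∣ p ∪ q ∣ ∣ p ∩ q ∣)
  (≡.trans (cong ℕ.suc (∣p∪q∣+∣p∩q∣≡∣p∣+∣q∣ p q)) (≡.sym (ℕ.+-suc ∣ p ∣ ∣ q ∣))))

-- Every element of `(p ∪ q) ∩ o` lies in `q ∩ o` or in `p` but not in `q`, and the elements of `p`
-- outside `q` together with `p ∩ q` number `∣ p ∣`. This is the submodularity inequality for a set
-- `p` without w and a set `q` with w.
∣[p∪q]∩o∣+∣p∩q∣≤∣p∣+∣q∩o∣ : (o p q : Subset n) →
  ∣ (p ∪ q) ∩ o ∣ ℕ.+ ∣ p ∩ q ∣ ℕ.≤ ∣ p ∣ ℕ.+ ∣ q ∩ o ∣
∣[p∪q]∩o∣+∣p∩q∣≤∣p∣+∣q∩o∣ []            []            []            = z≤n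
∣[p∪q]∩o∣+∣p∩q∣≤∣p∣+∣q∩o∣ (_ ∷ o)       (outside ∷ p) (outside ∷ q) =
  ∣[p∪q]∩o∣+∣p∩q∣≤∣p∣+∣q∩o∣ o p q
∣[p∪q]∩o∣+∣p∩q∣≤∣p∣+∣q∩o∣ (outside ∷ o) (outside ∷ p) (inside ∷ q)  =
  ∣[p∪q]∩o∣+∣p∩q∣≤∣p∣+∣q∩o∣ o p q
∣[p∪q]∩o∣+∣p∩q∣≤∣p∣+∣q∩o∣ (inside ∷ o)  (outside ∷ p) (inside ∷ q)
  rewrite ℕ.+-suc ∣ p ∣ ∣ q ∩ o ∣ = s≤s (∣[p∪q]∩o∣+∣p∩q∣≤∣p∣+∣q∩o∣ o p q)
∣[p∪q]∩o∣+∣p∩q∣≤∣p∣+∣q∩o∣ (outside ∷ o) (inside ∷ p)  (outside ∷ q) =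
  ℕ.m≤n⇒m≤1+n (∣[p∪q]∩o∣+∣p∩q∣≤∣p∣+∣q∩o∣ o p q)
∣[p∪q]∩o∣+∣p∩q∣≤∣p∣+∣q∩o∣ (inside ∷ o)  (inside ∷ p)  (outside ∷ q) =
  s≤s (∣[p∪q]∩o∣+∣p∩q∣≤∣p∣+∣q∩o∣ o p q)
∣[p∪q]∩o∣+∣p∩q∣≤∣p∣+∣q∩o∣ (outside ∷ o) (inside ∷ p)  (inside ∷ q)
  rewrite ℕ.+-suc ∣ (p ∪ q) ∩ o ∣ ∣ p ∩ q ∣ = s≤s (∣[p∪q]∩o∣+∣p∩q∣≤∣p∣+∣q∩o∣ o p q)
∣[p∪q]∩o∣+∣p∩q∣≤∣p∣+∣q∩o∣ (inside ∷ o)  (inside ∷ p)  (inside ∷ q)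
  rewrite ℕ.+-suc ∣ (p ∪ q) ∩ o ∣ ∣ p ∩ q ∣ | ℕ.+-suc ∣ p ∣ ∣ q ∩ o ∣ =
  s≤s (s≤s (∣[p∪q]∩o∣+∣p∩q∣≤∣p∣+∣q∩o∣ o p q))

∩-monoˡ-⊆ : (r : Subset n) {p q : Subset n} → p ⊆ q → p ∩ r ⊆ q ∩ r
∩-monoˡ-⊆ r {p} p⊆q x∈p∩r with x∈p , x∈r ← x∈p∩q⁻ p r x∈p∩r = x∈p∩q⁺ (p⊆q x∈p , x∈r)

x∉p∪⁅y⁆ : ∀ {p : Subset n} {x y} → x ∉ p → x ≢ y → x ∉ p ∪ ⁅ y ⁆
x∉p∪⁅y⁆ {p = p} {y = y} x∉p x≢y = [ x∉p , x≢y ∘ x∈⁅y⁆⇒x≡y y ]′ ∘ x∈p∪q⁻ p ⁅ y ⁆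

-- The hard set function

-- The element zero is the special element w.
hardValue : ℕ → Subset n → Subset (ℕ.suc n) → ℕ
hardValue K O (outside ∷ S) = ∣ S ∣
hardValue K O (inside ∷ S)  = K ℕ.+ ∣ S ∩ O ∣

-- If neither set contains w, or both do, the function is a constant plus a cardinality (in the
-- second case after restriction to `O`), so inclusion-exclusion suffices. The mixed case is the
-- inequality above, used in both orders by symmetry.
hardValue-submodular : ∀ K (O : Subset n) S T →
  hardValue K O (S ∪ T) ℕ.+ hardValue K O (S ∩ T) ℕ.≤ hardValue K O S ℕ.+ hardValue K O T
hardValue-submodular K O (outside ∷ S) (outside ∷ T) = ℕ.≤-reflexive (∣p∪q∣+∣p∩q∣≡∣p∣+∣q∣ S T)
hardValue-submodular K O (outside ∷ S) (inside ∷ T)  = begin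
  K ℕ.+ ∣ (S ∪ T) ∩ O ∣ ℕ.+ ∣ S ∩ T ∣    ≡⟨ ℕ.+-assoc K _ _ ⟩
  K ℕ.+ (∣ (S ∪ T) ∩ O ∣ ℕ.+ ∣ S ∩ T ∣)  ≤⟨ ℕ.+-monoʳ-≤ K (∣[p∪q]∩o∣+∣p∩q∣≤∣p∣+∣q∩o∣ O S T) ⟩
  K ℕ.+ (∣ S ∣ ℕ.+ ∣ T ∩ O ∣)            ≡⟨ swap K ∣ S ∣ _ ⟩
  ∣ S ∣ ℕ.+ (K ℕ.+ ∣ T ∩ O ∣)            ∎
  where
  open ℕ.≤-Reasoning
  swap : ∀ a b c → a ℕ.+ (b ℕ.+ c) ≡ b ℕ.+ (a ℕ.+ c)
  swap = ℕ-Solver.solve-∀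
hardValue-submodular K O (inside ∷ S)  (outside ∷ T)
  rewrite ∪-comm S T | ∩-comm S T | ℕ.+-comm (K ℕ.+ ∣ S ∩ O ∣) ∣ T ∣ =
  hardValue-submodular K O (outside ∷ T) (inside ∷ S)
hardValue-submodular K O (inside ∷ S)  (inside ∷ T)  = begin
  (K ℕ.+ ∣ (S ∪ T) ∩ O ∣) ℕ.+ (K ℕ.+ ∣ (S ∩ T) ∩ O ∣)
    ≤⟨ ℕ.+-mono-≤ (ℕ.≤-reflexive (cong (λ p → K ℕ.+ ∣ p ∣) (∩-distribʳ-∪ O S T)))
                  (ℕ.+-monoʳ-≤ K (p⊆q⇒∣p∣≤∣q∣ [S∩T]∩O⊆)) ⟩
  (K ℕ.+ ∣ S ∩ O ∪ T ∩ O ∣) ℕ.+ (K ℕ.+ ∣ (S ∩ O) ∩ (T ∩ O) ∣)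
    ≡⟨ interchange K ∣ S ∩ O ∪ T ∩ O ∣ _ ⟩
  (K ℕ.+ K) ℕ.+ (∣ S ∩ O ∪ T ∩ O ∣ ℕ.+ ∣ (S ∩ O) ∩ (T ∩ O) ∣)
    ≡⟨ cong (K ℕ.+ K ℕ.+_) (∣p∪q∣+∣p∩q∣≡∣p∣+∣q∣ (S ∩ O) (T ∩ O)) ⟩
  (K ℕ.+ K) ℕ.+ (∣ S ∩ O ∣ ℕ.+ ∣ T ∩ O ∣)
    ≡⟨ interchange K ∣ S ∩ O ∣ _ ⟨
  (K ℕ.+ ∣ S ∩ O ∣) ℕ.+ (K ℕ.+ ∣ T ∩ O ∣)
    ∎
  where
  open ℕ.≤-Reasoning
  interchange : ∀ a b c → (a ℕ.+ b) ℕ.+ (a ℕ.+ c) ≡ (a ℕ.+ a) ℕ.+ (b ℕ.+ c)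
  interchange = ℕ-Solver.solve-∀
  [S∩T]∩O⊆ : (S ∩ T) ∩ O ⊆ (S ∩ O) ∩ (T ∩ O)
  [S∩T]∩O⊆ x∈ = x∈p∩q⁺ (∩-monoˡ-⊆ O (p∩q⊆p S T) x∈ , ∩-monoˡ-⊆ O (p∩q⊆q S T) x∈)

-- A set without w is worth at most K + 1, which is at most 2K because K is positive; a set with w
-- gains at most `∣ O ∣` from its other elements.
hardValue-optimum : ∀ K (O : Subset n) → 1 ℕ.≤ K → ∣ O ∣ ≡ K →
  ∀ S → ∣ S ∣ ℕ.≤ ℕ.suc K → hardValue K O S ℕ.≤ hardValue K O (inside ∷ O)
hardValue-optimum K O 1≤K ∣O∣≡K (outside ∷ S) ∣S∣≤1+K = begin
  ∣ S ∣             ≤⟨ ∣S∣≤1+K ⟩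
  ℕ.suc K           ≤⟨ ℕ.+-monoˡ-≤ K 1≤K ⟩
  K ℕ.+ K           ≡⟨ cong (K ℕ.+_) ∣O∣≡K ⟨
  K ℕ.+ ∣ O ∣       ≡⟨ cong (λ p → K ℕ.+ ∣ p ∣) (∩-idem O) ⟨
  K ℕ.+ ∣ O ∩ O ∣   ∎
  where open ℕ.≤-Reasoning
hardValue-optimum K O 1≤K ∣O∣≡K (inside ∷ S) _ =
  ℕ.+-monoʳ-≤ K (ℕ.≤-trans (∣p∩q∣≤∣q∣ S O) (ℕ.≤-reflexive (cong ∣_∣ (≡.sym (∩-idem O)))))

-- Without w the size limit already gives K + 1. With w, the other elements of `S` must come from
-- `M`, so only `M` can contribute elements of `O`.
hardValue-of-kept : ∀ K (O : Subset n) (M S : Subset (ℕ.suc n)) → S ⊆ M ∪ ⁅ zero ⁆ →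
  ∣ S ∣ ℕ.≤ ℕ.suc K → hardValue K O S ℕ.≤ ℕ.suc K ℕ.+ ∣ tail M ∩ O ∣
hardValue-of-kept K O M       (outside ∷ S) _  ∣S∣≤1+K = ℕ.≤-trans ∣S∣≤1+K (ℕ.m≤m+n _ _)
hardValue-of-kept K O (_ ∷ M) (inside ∷ S)  S⊆ _       =
  ℕ.+-mono-≤ (ℕ.n≤1+n K) (p⊆q⇒∣p∣≤∣q∣ (∩-monoˡ-⊆ O S⊆M))
  where
  S⊆M : S ⊆ M
  S⊆M = subst (S ⊆_) (∪-identityʳ M) (drop-∷-⊆ S⊆)

-- Sums over lists and packings of disjoint K-element blocks

sum-map-const+ : {B : Set} (c : ℕ) (f : B → ℕ) (bs : List B) →
  ℕ.sum (map (λ b → c ℕ.+ f b) bs) ≡ length bs ℕ.* c ℕ.+ ℕ.sum (map f bs)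
sum-map-const+ c f []       = refl
sum-map-const+ c f (b ∷ bs) = ≡.trans
  (cong (c ℕ.+ f b ℕ.+_) (sum-map-const+ c f bs)) (interchange c (f b) (length bs ℕ.* c) _)
  where
  interchange : ∀ w x y z → (w ℕ.+ x) ℕ.+ (y ℕ.+ z) ≡ (w ℕ.+ y) ℕ.+ (x ℕ.+ z)
  interchange = ℕ-Solver.solve-∀

-- Equivalent to pairwise disjointness of the listed sets.
Packed : List (Subset n) → Set
Packed {n} Os = (M : Subset n) → ℕ.sum (map (λ O → ∣ M ∩ O ∣) Os) ℕ.≤ ∣ M ∣

-- An intermediate stage of a greedy construction: `partial` is the block being filled, with `j`
-- elements so far, and `full` holds the `L` finished blocks.
record Packing (K n L j : ℕ) : Set where
  field
    partial      : Subset n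
    full         : List (Subset n)
    packed       : Packed (partial ∷ full)
    ∣partial∣≡j  : ∣ partial ∣ ≡ j
    ∣full∣≡K     : All (λ O → ∣ O ∣ ≡ K) full
    length≡L     : length full ≡ L

packed-⊥ : (Os : List (Subset n)) → Packed Os → Packed (⊥ ∷ Os)
packed-⊥ {n} _ packed M rewrite ∩-zeroʳ M | ∣⊥∣≡0 n = packed M

sum-outside : ∀ b (M : Subset n) Os →
  ℕ.sum (map (λ O → ∣ (b ∷ M) ∩ O ∣) (map (outside ∷_) Os)) ≡ ℕ.sum (map (λ O → ∣ M ∩ O ∣) Os)
sum-outside b       M []       = refl
sum-outside inside  M (O ∷ Os) = cong (∣ M ∩ O ∣ ℕ.+_) (sum-outside inside M Os)
sum-outside outside M (O ∷ Os) = cong (∣ M ∩ O ∣ ℕ.+_) (sum-outside outside M Os)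

-- The new element belongs to the first block only, so a set containing it gains exactly one on each
-- side of the inequality.
packed-inside : ∀ (O : Subset n) Os → Packed (O ∷ Os) →
  Packed ((inside ∷ O) ∷ map (outside ∷_) Os)
packed-inside _ Os packed (inside ∷ M)  rewrite sum-outside inside M Os  = s≤s (packed M)
packed-inside _ Os packed (outside ∷ M) rewrite sum-outside outside M Os = packed M

addElements : ∀ {K n L} j → Packing K n L 0 → Packing K (j ℕ.+ n) L j
addElements ℕ.zero    P = P
addElements (ℕ.suc j) P = record
  { partial     = inside ∷ partial
  ; full        = map (outside ∷_) full
  ; packed      = packed-inside partial full packed
  ; ∣partial∣≡j = cong ℕ.suc ∣partial∣≡j
  ; ∣full∣≡K    = All.map⁺ ∣full∣≡K
  ; length≡L    = ≡.trans (length-map (outside ∷_) full) length≡L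
  }
  where open Packing (addElements j P)

closeBlock : ∀ {K n L} → Packing K n L K → Packing K n (ℕ.suc L) 0
closeBlock {n = n} P = record
  { partial     = ⊥
  ; full        = partial ∷ full
  ; packed      = packed-⊥ (partial ∷ full) packed
  ; ∣partial∣≡j = ∣⊥∣≡0 n
  ; ∣full∣≡K    = ∣partial∣≡j ∷ ∣full∣≡K
  ; length≡L    = cong ℕ.suc length≡L
  }
  where open Packing P

-- Starting from `r` elements that stay in no block, each round adds K fresh elements to an empty
-- `partial` and then closes it.
packing : ∀ K r L → Packing K (L ℕ.* K ℕ.+ r) L 0
packing K r ℕ.zero    = record
  { partial     = ⊥
  ; full        = []
  ; packed      = packed-⊥ [] (λ _ → z≤n)
  ; ∣partial∣≡j = ∣⊥∣≡0 r
  ; ∣full∣≡K    = []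
  ; length≡L    = refl
  }
packing K r (ℕ.suc L) = subst (λ n → Packing K n (ℕ.suc L) 0) (≡.sym (ℕ.+-assoc K (L ℕ.* K) r))
  (closeBlock (addElements K (packing K r L)))

disjointBlocks : ∀ K .{{_ : ℕ.NonZero K}} n → ∃ λ (Os : List (Subset n)) →
  Packed Os × All (λ O → ∣ O ∣ ≡ K) Os × length Os ≡ n / K
-- Dropping `partial` only lowers the sum of intersections.
disjointBlocks K n = full , (λ M → ℕ.≤-trans (ℕ.m≤n+m _ _) (packed M)) , ∣full∣≡K , length≡L
  where
  n≡ : n / K ℕ.* K ℕ.+ n % K ≡ n
  n≡ = ≡.trans (ℕ.+-comm (n / K ℕ.* K) (n % K)) (≡.sym (m≡m%n+[m/n]*n n K))
  open Packing (subst (λ n′ → Packing K n′ (n / K) 0) n≡ (packing K (n % K) (n / K)))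

-- Arithmetic in an ordered field

module OrderedField (ℝ : ArchimedeanOrderedField) where
  open ArchimedeanOrderedField ℝ renaming (refl to ≈-refl)

  poset : Poset _ _ _
  poset = record { isPartialOrder = IsTotalOrder.isPartialOrder isTotalOrder }

  open Poset poset public using ()
    renaming (refl to ≤-refl; reflexive to ≤-reflexive; trans to ≤-trans; antisym to ≤-antisym)
  open IsTotalOrder isTotalOrder public using () renaming (total to ≤-total)
  open PosetReasoning poset
  open SemiringMult semiring using (×1-homo-*)
  open RingProperties ring using (x[y-z]≈xy-xz; [y-z]x≈yx-zx; -1*x≈-x; -‿involutive)
  open *-Properties *-commutativeSemigroup using (x∙yz≈y∙xz)
  open Mult +-monoid using (×-homo-+)

  +-mono-≤ : ∀ {w x y z} → w ≤ x → y ≤ z → w + y ≤ x + z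
  +-mono-≤ {w} {x} {y} {z} w≤x y≤z = begin
    w + y  ≤⟨ +-monoʳ-≤ w y≤z ⟩
    w + z  ≈⟨ +-comm w z ⟩
    z + w  ≤⟨ +-monoʳ-≤ z w≤x ⟩
    z + x  ≈⟨ +-comm z x ⟩
    x + z  ∎

  x≤y⇒0≤y-x : ∀ {x y} → x ≤ y → 0# ≤ y - x
  x≤y⇒0≤y-x {x} {y} x≤y = begin
    0#       ≈⟨ -‿inverseˡ x ⟨
    - x + x  ≤⟨ +-monoʳ-≤ (- x) x≤y ⟩
    - x + y  ≈⟨ +-comm (- x) y ⟩
    y - x    ∎

  x≤y-z⇒x+z≤y : ∀ {x y z} → x ≤ y - z → x + z ≤ y
  x≤y-z⇒x+z≤y {x} {y} {z} x≤y-z = begin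
    x + z          ≤⟨ +-mono-≤ x≤y-z ≤-refl ⟩
    (y - z) + z    ≈⟨ +-assoc y (- z) z ⟩
    y + (- z + z)  ≈⟨ +-congˡ (-‿inverseˡ z) ⟩
    y + 0#         ≈⟨ +-identityʳ y ⟩
    y              ∎

  0≤y-x⇒x≤y : ∀ {x y} → 0# ≤ y - x → x ≤ y
  0≤y-x⇒x≤y {x} {y} 0≤y-x = begin
    x       ≈⟨ +-identityˡ x ⟨
    0# + x  ≤⟨ x≤y-z⇒x+z≤y 0≤y-x ⟩
    y       ∎

  *-monoʳ-≤ : ∀ {x y z} → 0# ≤ x → y ≤ z → x * y ≤ x * z
  *-monoʳ-≤ {x} {y} {z} 0≤x y≤z = 0≤y-x⇒x≤y (begin
    0#             ≤⟨ *-nonneg 0≤x (x≤y⇒0≤y-x y≤z) ⟩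
    x * (z - y)    ≈⟨ x[y-z]≈xy-xz x z y ⟩
    x * z - x * y  ∎)

  x≤0⇒0≤-x : ∀ {x} → x ≤ 0# → 0# ≤ - x
  x≤0⇒0≤-x {x} x≤0 = begin
    0#      ≤⟨ x≤y⇒0≤y-x x≤0 ⟩
    0# - x  ≈⟨ +-identityˡ (- x) ⟩
    - x     ∎

  0≤1 : 0# ≤ 1#
  0≤1 with ≤-total 0# 1#
  ... | inj₁ 0≤1 = 0≤1
  -- If 1 ≤ 0 then -1 is non-negative, hence so is its square, which is 1.
  ... | inj₂ 1≤0 = begin
    0#           ≤⟨ *-nonneg (x≤0⇒0≤-x 1≤0) (x≤0⇒0≤-x 1≤0) ⟩
    - 1# * - 1#  ≈⟨ -1*x≈-x (- 1#) ⟩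
    - - 1#       ≈⟨ -‿involutive 1# ⟩
    1#           ∎

  1≰0 : ¬ (1# ≤ 0#)
  1≰0 1≤0 = 0≉1 (≤-antisym 0≤1 1≤0)

  fromℕ-homo-+ : ∀ m n → fromℕ (m ℕ.+ n) ≈ fromℕ m + fromℕ n
  fromℕ-homo-+ = ×-homo-+ 1#

  fromℕ-homo-* : ∀ m n → fromℕ (m ℕ.* n) ≈ fromℕ m * fromℕ n
  fromℕ-homo-* = ×1-homo-*

  0≤fromℕ : ∀ n → 0# ≤ fromℕ n
  0≤fromℕ ℕ.zero    = ≤-refl
  0≤fromℕ (ℕ.suc n) = begin
    0#            ≈⟨ +-identityˡ 0# ⟨
    0# + 0#       ≤⟨ +-mono-≤ 0≤1 (0≤fromℕ n) ⟩
    1# + fromℕ n  ∎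

  fromℕ-mono-≤ : ∀ {m n} → m ℕ.≤ n → fromℕ m ≤ fromℕ n
  fromℕ-mono-≤ {n = n} z≤n = 0≤fromℕ n
  fromℕ-mono-≤ (s≤s m≤n)   = +-monoʳ-≤ 1# (fromℕ-mono-≤ m≤n)

  fromℕ-cancel-≤ : ∀ {m n} → fromℕ m ≤ fromℕ n → m ℕ.≤ n
  fromℕ-cancel-≤ {ℕ.zero}            _ = z≤n
  fromℕ-cancel-≤ {ℕ.suc m} {ℕ.zero}  p = contradiction (begin
    1#            ≈⟨ +-identityʳ 1# ⟨
    1# + 0#       ≤⟨ +-monoʳ-≤ 1# (0≤fromℕ m) ⟩
    1# + fromℕ m  ≤⟨ p ⟩
    0#            ∎) 1≰0
  fromℕ-cancel-≤ {ℕ.suc m} {ℕ.suc n} p = s≤s (fromℕ-cancel-≤ (begin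
    fromℕ m                ≈⟨ cancel (fromℕ m) ⟨
    - 1# + (1# + fromℕ m)  ≤⟨ +-monoʳ-≤ (- 1#) p ⟩
    - 1# + (1# + fromℕ n)  ≈⟨ cancel (fromℕ n) ⟩
    fromℕ n                ∎))
    where
    cancel : ∀ x → - 1# + (1# + x) ≈ x
    cancel x = trans (sym (+-assoc (- 1#) 1# x)) (trans (+-congʳ (-‿inverseˡ 1#)) (+-identityˡ x))

  inverse-positive : ∀ {x y} → 0# ≤ x → x * y ≈ 1# → 0# < y
  inverse-positive {x} {y} 0≤x xy≈1 = 0≤y (≤-total 0# y) , 0≉y
    where
    0≉y : ¬ (0# ≈ y)
    0≉y 0≈y = 0≉1 (trans (trans (sym (zeroʳ x)) (*-congˡ 0≈y)) xy≈1)
    0≤y : 0# ≤ y ⊎ y ≤ 0# → 0# ≤ y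
    0≤y (inj₁ 0≤y) = 0≤y
    0≤y (inj₂ y≤0) = contradiction (begin
      1#      ≈⟨ xy≈1 ⟨
      x * y   ≤⟨ *-monoʳ-≤ 0≤x y≤0 ⟩
      x * 0#  ≈⟨ zeroʳ x ⟩
      0#      ∎) 1≰0

  ∑ : {B : Set} → List B → (B → Carrier) → Carrier
  ∑ []       f = 0#
  ∑ (b ∷ bs) f = f b + ∑ bs f

  ∑-fromℕ : {B : Set} (bs : List B) (f : B → ℕ) → ∑ bs (fromℕ ∘ f) ≈ fromℕ (ℕ.sum (map f bs))
  ∑-fromℕ []       f = ≈-refl
  ∑-fromℕ (b ∷ bs) f = trans (+-congˡ (∑-fromℕ bs f)) (sym (fromℕ-homo-+ (f b) _))

  ∑-mono-≤ : {B : Set} (bs : List B) {f g : B → Carrier} → (∀ b → f b ≤ g b) → ∑ bs f ≤ ∑ bs g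
  ∑-mono-≤ []       f≤g = ≤-refl
  ∑-mono-≤ (b ∷ bs) f≤g = +-mono-≤ (f≤g b) (∑-mono-≤ bs f≤g)

  fromℕ-length*≤*∑ : {B : Set} {bs : List B} {f : B → Carrier} (a : ℕ) (x : Carrier) →
    All (λ b → fromℕ a ≤ x * f b) bs → fromℕ (length bs ℕ.* a) ≤ x * ∑ bs f
  fromℕ-length*≤*∑ a x []                             = ≤-reflexive (sym (zeroʳ x))
  fromℕ-length*≤*∑ {bs = b ∷ bs} {f} a x (p ∷ ps) = begin
    fromℕ (a ℕ.+ length bs ℕ.* a)        ≈⟨ fromℕ-homo-+ a _ ⟩
    fromℕ a + fromℕ (length bs ℕ.* a)    ≤⟨ +-mono-≤ p (fromℕ-length*≤*∑ a x ps) ⟩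
    x * f b + x * ∑ bs f                 ≈⟨ distribˡ x _ _ ⟨
    x * (f b + ∑ bs f)                   ∎

  -- The hypothesis gives 2K + εE ≤ 2E, hence 2K ≤ 2E; feeding this back into εE
  -- yields the surplus 2εK ≥ 6 without knowing the sign of 2 - ε.
  competitive-surplus : ∀ {ε E} K → 0# ≤ ε → 0# ≤ E → fromℕ 3 ≤ ε * fromℕ K →
    fromℕ (2 ℕ.* K) ≤ (fromℕ 2 - ε) * E → fromℕ (4 ℕ.* K ℕ.+ 6) ≤ fromℕ 4 * E
  competitive-surplus {ε} {E} K 0≤ε 0≤E 3≤εK hyp = begin
    fromℕ (4 ℕ.* K ℕ.+ 6)                    ≡⟨ cong fromℕ (lemma₁ K) ⟩
    fromℕ (2 ℕ.* (2 ℕ.* K) ℕ.+ 2 ℕ.* 3)      ≈⟨ trans (fromℕ-homo-+ (2 ℕ.* (2 ℕ.* K)) _)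
                                                      (+-cong (fromℕ-homo-* 2 (2 ℕ.* K)) (fromℕ-homo-* 2 3)) ⟩
    t * fromℕ (2 ℕ.* K) + t * fromℕ 3        ≤⟨ +-monoʳ-≤ _ (*-monoʳ-≤ 0≤t 3≤εK) ⟩
    t * fromℕ (2 ℕ.* K) + t * (ε * fromℕ K)  ≈⟨ +-congˡ (trans (x∙yz≈y∙xz t ε (fromℕ K))
                                                              (*-congˡ (sym (fromℕ-homo-* 2 K)))) ⟩
    t * fromℕ (2 ℕ.* K) + ε * fromℕ (2 ℕ.* K) ≤⟨ +-monoʳ-≤ _ (*-monoʳ-≤ 0≤ε 2K≤2E) ⟩
    t * fromℕ (2 ℕ.* K) + ε * (t * E)        ≈⟨ trans (+-congˡ (x∙yz≈y∙xz ε t E)) (sym (distribˡ t _ _)) ⟩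
    t * (fromℕ (2 ℕ.* K) + ε * E)            ≤⟨ *-monoʳ-≤ 0≤t 2K+εE≤2E ⟩
    t * (t * E)                              ≈⟨ trans (sym (*-assoc t t E))
                                                      (*-congʳ (sym (fromℕ-homo-* 2 2))) ⟩
    fromℕ 4 * E                              ∎
    where
    t = fromℕ 2
    0≤t : 0# ≤ t
    0≤t = 0≤fromℕ 2
    lemma₁ : ∀ K → 4 ℕ.* K ℕ.+ 6 ≡ 2 ℕ.* (2 ℕ.* K) ℕ.+ 2 ℕ.* 3
    lemma₁ = ℕ-Solver.solve-∀
    2K+εE≤2E : fromℕ (2 ℕ.* K) + ε * E ≤ t * E
    2K+εE≤2E = x≤y-z⇒x+z≤y (≤-trans hyp (≤-reflexive ([y-z]x≈yx-zx E t ε)))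
    2K≤2E : fromℕ (2 ℕ.* K) ≤ t * E
    2K≤2E = begin
      fromℕ (2 ℕ.* K)          ≈⟨ +-identityʳ _ ⟨
      fromℕ (2 ℕ.* K) + 0#     ≤⟨ +-monoʳ-≤ _ (*-nonneg 0≤ε 0≤E) ⟩
      fromℕ (2 ℕ.* K) + ε * E  ≤⟨ 2K+εE≤2E ⟩
      t * E                    ∎

module LowerBound (ℝ : ArchimedeanOrderedField) where
  open ArchimedeanOrderedField ℝ hiding (zero; refl) renaming (reflexive to ≈-reflexive)
  open OrderedField ℝ
  open Streaming ℝ

  -- Expectations of finite sums

  module _ (P : ProbabilitySpace) where
    open ProbabilitySpace P

    -- `𝔼` takes an integrability proof as argument, so the proof for the sum is returned together
    -- with the value that `𝔼` gives on that very proof.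
    𝔼-∑ : {B : Set} {X : B → Outcome → Carrier} (i : ∀ b → Integrable (X b)) (bs : List B) →
      Σ (Integrable (λ ω → ∑ bs (λ b → X b ω))) λ j → 𝔼 j ≈ ∑ bs (λ b → 𝔼 (i b))
    𝔼-∑ i []       = int-const 0# , 𝔼-const 0# _
    𝔼-∑ i (b ∷ bs) with j , 𝔼j≈ ← 𝔼-∑ i bs =
      int-+ (i b) j , trans (𝔼-+ (i b) j) (+-congˡ 𝔼j≈)

    ∑𝔼≤ : {B : Set} {X : B → Outcome → Carrier} (i : ∀ b → Integrable (X b)) (bs : List B) {c : Carrier} →
      (∀ ω → ∑ bs (λ b → X b ω) ≤ c) → ∑ bs (λ b → 𝔼 (i b)) ≤ c
    ∑𝔼≤ i bs {c} ∑X≤c with j , 𝔼j≈ ← 𝔼-∑ i bs = begin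
      ∑ bs (λ b → 𝔼 (i b))  ≈⟨ 𝔼j≈ ⟨
      𝔼 j                   ≤⟨ 𝔼-mono j (int-const c) ∑X≤c ⟩
      𝔼 (int-const c)       ≈⟨ 𝔼-const c _ ⟩
      c                     ∎
      where open PosetReasoning poset

    𝔼-nonneg : {X : Outcome → Carrier} (i : Integrable X) → (∀ ω → 0# ≤ X ω) → 0# ≤ 𝔼 i
    𝔼-nonneg i 0≤X = ≤-trans (≤-reflexive (sym (𝔼-const 0# _))) (𝔼-mono (int-const 0#) i 0≤X)

  -- Runs of a streaming algorithm

  -- All queries are subsets of `M`, so by induction both oracles lead down the same branch. The
  -- values must agree up to `≡`, since a continuation need not respect `≈`.
  answer-cong : ∀ {n} {M : Subset n} {B : Set} {f g : SetFunction n} →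
    (∀ T → T ⊆ M → f T ≡ g T) → (c : OracleComp M B) → answer f c ≡ answer g c
  answer-cong f≡g (return _)       = refl
  answer-cong {g = g} f≡g (query T T⊆M cont) rewrite f≡g T T⊆M = answer-cong f≡g (cont (g T))

  module _ {n k : ℕ} (A : AlgorithmFor n k) where
    open AlgorithmFor A

    stateAfter : SetFunction n → Outcome → State → List (Fin n) → State
    stateAfter f ω = foldl (next f ω)

    -- The last step can retain only what was stored before it and `e`, and `finish` can output only
    -- what is then stored.
    outputFrom-⊆ : ∀ f ω s es e → outputFrom f ω s (es ++ e ∷ []) ⊆ stored (stateAfter f ω s es) ∪ ⁅ e ⁆
    outputFrom-⊆ f ω s []       e = proj₂ (answer f (step ω s e)) ∘ proj₂ (answer f (finish ω (next f ω s e)))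
    outputFrom-⊆ f ω s (d ∷ es) e = outputFrom-⊆ f ω (next f ω s d) es e

    ∣stored∣≤peak : ∀ f ω s es ds → ∣ stored (stateAfter f ω s es) ∣ ℕ.≤ peakFrom f ω s (es ++ ds)
    ∣stored∣≤peak f ω s []       []      = stored≤space s
    ∣stored∣≤peak f ω s []       (_ ∷ _) = ℕ.≤-trans (stored≤space s) (ℕ.m≤m⊔n _ _)
    ∣stored∣≤peak f ω s (e ∷ es) ds      = ℕ.≤-trans (∣stored∣≤peak f ω _ es ds) (ℕ.m≤n⊔m (space s) _)

    module _ {w : Fin n} {f g : SetFunction n} (f≡g : ∀ T → w ∉ T → f T ≡ g T) where

      -- The invariant is that `w` is not stored. While other elements arrive, every query therefore
      -- avoids `w`, where the two functions agree, and the next state again does not store `w`.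
      stateAfter-cong : ∀ ω s es → w ∉ stored s → All (w ≢_) es → stateAfter f ω s es ≡ stateAfter g ω s es
      stateAfter-cong ω s []       _    _            = refl
      stateAfter-cong ω s (e ∷ es) w∉s (w≢e ∷ w≢es)
        rewrite answer-cong {f = f} {g} (λ T T⊆ → f≡g T (x∉p∪⁅y⁆ w∉s w≢e ∘ T⊆)) (step ω s e) =
        stateAfter-cong ω (next g ω s e) es (x∉p∪⁅y⁆ w∉s w≢e ∘ proj₂ (answer g (step ω s e))) w≢es

  -- Inputs in which w arrives last

  module _ {n : ℕ} where

    others : List (Fin (ℕ.suc n))
    others = map suc (allFin n)

    zeroLast : List (Fin (ℕ.suc n))
    zeroLast = others ++ zero ∷ []

    zeroLast-arrivesOnce : zeroLast ↭ allFin (ℕ.suc n)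
    zeroLast-arrivesOnce = ↭-trans (↭-sym (∷↭∷ʳ zero others))
      (↭-reflexive (cong (zero ∷_) (map-tabulate id suc)))

    integerInput : ∀ {k} → 1 ℕ.≤ k → (v : Subset (ℕ.suc n) → ℕ) →
      (∀ S T → v (S ∪ T) ℕ.+ v (S ∩ T) ℕ.≤ v S ℕ.+ v T) → Input (ℕ.suc n) k
    integerInput 1≤k v v-submodular = record
      { k-positive  = 1≤k
      ; f           = fromℕ ∘ v
      ; nonNegative = 0≤fromℕ ∘ v
      ; submodular  = λ S T → begin
          fromℕ (v (S ∪ T)) + fromℕ (v (S ∩ T))  ≈⟨ fromℕ-homo-+ (v (S ∪ T)) _ ⟨
          fromℕ (v (S ∪ T) ℕ.+ v (S ∩ T))        ≤⟨ fromℕ-mono-≤ (v-submodular S T) ⟩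
          fromℕ (v S ℕ.+ v T)                    ≈⟨ fromℕ-homo-+ (v S) _ ⟩
          fromℕ (v S) + fromℕ (v T)              ∎
      ; stream      = zeroLast
      ; arrivesOnce = zeroLast-arrivesOnce
      }
      where open PosetReasoning poset

    hardInput : ∀ K → Subset n → Input (ℕ.suc n) (ℕ.suc K)
    hardInput K O = integerInput (s≤s z≤n) (hardValue K O) (hardValue-submodular K O)

    -- A valid input in its own right: the memory guarantee on it will bound the set held just
    -- before w arrives, for all hidden sets `O` at once.
    cardinalityInput : ∀ K → Input (ℕ.suc n) (ℕ.suc K)
    cardinalityInput K = integerInput (s≤s z≤n) ∣_∣ (λ S T → ℕ.≤-reflexive (∣p∪q∣+∣p∩q∣≡∣p∣+∣q∣ S T))

    hardInput-optimal : ∀ K O → 1 ℕ.≤ K → ∣ O ∣ ≡ K →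
      IsOptimal (Input.f (hardInput K O)) (ℕ.suc K) (inside ∷ O)
    hardInput-optimal K O 1≤K ∣O∣≡K =
      s≤s (ℕ.≤-reflexive ∣O∣≡K) , λ S ∣S∣≤ → fromℕ-mono-≤ (hardValue-optimum K O 1≤K ∣O∣≡K S ∣S∣≤)

    -- Summing over the hidden blocks

    module _ {K : ℕ} (A : AlgorithmFor (ℕ.suc n) (ℕ.suc K)) where
      open AlgorithmFor A

      -- Oracle answers before zero arrives are cardinalities for every O, so the
      -- run on the cardinality function determines what is stored at that point.
      kept : Outcome → Subset (ℕ.suc n)
      kept ω = stored (stateAfter A (fromℕ ∘ ∣_∣) ω init others)

      result : Subset n → Outcome → ℕ
      result O ω = hardValue K O (output (fromℕ ∘ hardValue K O) zeroLast ω)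

      -- Before `zero` arrives, the run on the hard function and the run on cardinality are in the
      -- same state; afterwards only `zero` can be added.
      output-⊆ : ∀ O ω → output (fromℕ ∘ hardValue K O) zeroLast ω ⊆ kept ω ∪ ⁅ zero ⁆
      output-⊆ O ω = subst (λ s → output f zeroLast ω ⊆ stored s ∪ ⁅ zero ⁆)
        (stateAfter-cong A {w = zero} f≡card ω init others zero∉init
          (All.map⁺ (universal (λ _ ()) (allFin n))))
        (outputFrom-⊆ A f ω init others zero)
        where
        f : SetFunction (ℕ.suc n)
        f = fromℕ ∘ hardValue K O
        f≡card : ∀ T → zero ∉ T → f T ≡ fromℕ ∣ T ∣
        f≡card (outside ∷ T) _   = refl
        f≡card (inside ∷ T)  0∉T = contradiction here 0∉T
        zero∉init : zero ∉ stored init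
        zero∉init = subst (zero ∉_) (≡.sym init-empty) ∉⊥

      -- For a fixed outcome the same set `kept ω` serves every `O`, and disjointness of the blocks
      -- bounds their joint share of it by its size.
      total-value-≤ : ∀ Os → Packed Os → ∀ ω →
        (∀ O → ∣ output (fromℕ ∘ hardValue K O) zeroLast ω ∣ ℕ.≤ ℕ.suc K) →
        ∑ Os (λ O → fromℕ (result O ω))
          ≤ fromℕ (length Os ℕ.* ℕ.suc K ℕ.+ ∣ kept ω ∣)
      total-value-≤ Os packed ω feasible = begin
        ∑ Os (λ O → fromℕ (result O ω))
          ≤⟨ ∑-mono-≤ Os (λ O → fromℕ-mono-≤ (hardValue-of-kept K O (kept ω) _ (output-⊆ O ω) (feasible O))) ⟩
        ∑ Os (λ O → fromℕ (ℕ.suc K ℕ.+ ∣ tail (kept ω) ∩ O ∣))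
          ≈⟨ ∑-fromℕ Os (λ O → ℕ.suc K ℕ.+ ∣ tail (kept ω) ∩ O ∣) ⟩
        fromℕ (ℕ.sum (map (λ O → ℕ.suc K ℕ.+ ∣ tail (kept ω) ∩ O ∣) Os))
          ≡⟨ cong fromℕ (sum-map-const+ (ℕ.suc K) _ Os) ⟩
        fromℕ (length Os ℕ.* ℕ.suc K ℕ.+ ℕ.sum (map (λ O → ∣ tail (kept ω) ∩ O ∣) Os))
          ≤⟨ fromℕ-mono-≤ (ℕ.+-monoʳ-≤ (length Os ℕ.* ℕ.suc K)
               (ℕ.≤-trans (packed (tail (kept ω))) (∣tail∣≤ (kept ω)))) ⟩
        fromℕ (length Os ℕ.* ℕ.suc K ℕ.+ ∣ kept ω ∣)
          ∎
        where
        open PosetReasoning poset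
        ∣tail∣≤ : (p : Subset (ℕ.suc n)) → ∣ tail p ∣ ℕ.≤ ∣ p ∣
        ∣tail∣≤ (x ∷ p) = ∣p∣≤∣x∷p∣ x p

      -- With L blocks, summing the surplus bounds and comparing with the total value gives L(4K +
      -- 6) ≤ 4(L(K + 1) + m). Cancelling 4L(K + 1) leaves 2L ≤ 4m.
      blocks≤2*memory : ∀ {ε m} → 1 ℕ.≤ K → 0# ≤ ε → fromℕ 3 ≤ ε * fromℕ K →
        (∀ I → CompetitiveOn (fromℕ 2 - ε) A I) → (∀ ω → ∣ kept ω ∣ ℕ.≤ m) →
        (Os : List (Subset n)) → Packed Os → All (λ O → ∣ O ∣ ≡ K) Os → length Os ℕ.≤ 2 ℕ.* m
      blocks≤2*memory {ε} {m} 1≤K 0≤ε 3≤εK competitive kept≤m Os packed ∣Os∣≡K =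
        ℕ.*-cancelˡ-≤ 2 (ℕ.+-cancelˡ-≤ (4 ℕ.* (L ℕ.* ℕ.suc K)) _ _
          (≡.subst₂ ℕ._≤_ (lemma₁ L K) (lemma₂ (L ℕ.* ℕ.suc K) m) (fromℕ-cancel-≤ (begin
            fromℕ (L ℕ.* (4 ℕ.* K ℕ.+ 6))
              ≤⟨ fromℕ-length*≤*∑ (4 ℕ.* K ℕ.+ 6) (fromℕ 4) (All-map surplus ∣Os∣≡K) ⟩
            fromℕ 4 * ∑ Os E
              ≤⟨ *-monoʳ-≤ (0≤fromℕ 4) (∑𝔼≤ randomness integrable Os ∑≤) ⟩
            fromℕ 4 * fromℕ (L ℕ.* ℕ.suc K ℕ.+ m)
              ≈⟨ fromℕ-homo-* 4 (L ℕ.* ℕ.suc K ℕ.+ m) ⟨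
            fromℕ (4 ℕ.* (L ℕ.* ℕ.suc K ℕ.+ m))
              ∎))))
        where
        open PosetReasoning poset
        L = length Os
        integrable : ∀ O → Integrable (fromℕ ∘ result O)
        integrable O = proj₁ (proj₂ (competitive (hardInput K O)))
        E : Subset n → Carrier
        E O = 𝔼 (integrable O)
        ∑≤ : ∀ ω → ∑ Os (λ O → fromℕ (result O ω)) ≤ fromℕ (L ℕ.* ℕ.suc K ℕ.+ m)
        ∑≤ ω = ≤-trans (total-value-≤ Os packed ω (λ O → proj₁ (competitive (hardInput K O)) ω))
          (fromℕ-mono-≤ (ℕ.+-monoʳ-≤ (L ℕ.* ℕ.suc K) (kept≤m ω)))
        optimum : ∀ O → ∣ O ∣ ≡ K → 2 ℕ.* K ≡ K ℕ.+ ∣ O ∩ O ∣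
        optimum O ∣O∣≡K = cong (K ℕ.+_)
          (≡.trans (ℕ.+-identityʳ K) (≡.trans (≡.sym ∣O∣≡K) (cong ∣_∣ (≡.sym (∩-idem O)))))
        surplus : ∀ {O} → ∣ O ∣ ≡ K → fromℕ (4 ℕ.* K ℕ.+ 6) ≤ fromℕ 4 * E O
        surplus {O} ∣O∣≡K = competitive-surplus K 0≤ε
          (𝔼-nonneg randomness (integrable O) (λ ω → 0≤fromℕ (result O ω))) 3≤εK
          (≤-trans (≤-reflexive (≈-reflexive (cong fromℕ (optimum O ∣O∣≡K))))
            (proj₂ (proj₂ (competitive (hardInput K O))) (inside ∷ O) (hardInput-optimal K O 1≤K ∣O∣≡K)))
        lemma₁ : ∀ L K → L ℕ.* (4 ℕ.* K ℕ.+ 6) ≡ 4 ℕ.* (L ℕ.* ℕ.suc K) ℕ.+ 2 ℕ.* L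
        lemma₁ = ℕ-Solver.solve-∀
        lemma₂ : ∀ a m → 4 ℕ.* (a ℕ.+ m) ≡ 4 ℕ.* a ℕ.+ 2 ℕ.* (2 ℕ.* m)
        lemma₂ = ℕ-Solver.solve-∀

  -- Here `n` counts w as well, so the blocks are cut from the remaining n - 1 elements, and n ≤ (1
  -- + L)K for the number L of blocks.
  memory-linear : ∀ {ε} K .{{_ : ℕ.NonZero K}} → 0# ≤ ε → fromℕ 3 ≤ ε * fromℕ K →
    (A : StreamingAlgorithm) → Competitive (fromℕ 2 - ε) A →
    (m : ℕ → ℕ → ℕ) → UsesMemoryAtMost A m →
    ∀ n → ℕ.suc K ℕ.≤ n → n ℕ.≤ 4 ℕ.* K ℕ.* m n (ℕ.suc K)
  memory-linear K 0≤ε 3≤εK A competitive m memory (ℕ.suc n) (s≤s K≤n)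
    with Os , packed , ∣Os∣≡K , length≡ ← disjointBlocks K n = begin
      ℕ.suc n                          ≡⟨ cong ℕ.suc (m≡m%n+[m/n]*n n K) ⟩
      ℕ.suc (n % K) ℕ.+ L ℕ.* K        ≤⟨ ℕ.+-monoˡ-≤ (L ℕ.* K) (m%n<n n K) ⟩
      -- There is at least one block, so the rounding loss of K is absorbed by doubling L.
      K ℕ.+ L ℕ.* K                    ≤⟨ ℕ.*-monoˡ-≤ K (ℕ.+-monoˡ-≤ L (m≥n⇒m/n>0 K≤n)) ⟩
      (L ℕ.+ L) ℕ.* K                  ≤⟨ ℕ.*-monoˡ-≤ K (ℕ.+-mono-≤ L≤2m L≤2m) ⟩
      (2 ℕ.* M ℕ.+ 2 ℕ.* M) ℕ.* K      ≡⟨ lemma M K ⟩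
      4 ℕ.* K ℕ.* M                    ∎
      where
      open ℕ.≤-Reasoning
      L = n / K
      M = m (ℕ.suc n) (ℕ.suc K)
      L≤2m : L ℕ.≤ 2 ℕ.* M
      L≤2m = subst (ℕ._≤ 2 ℕ.* M) length≡ (blocks≤2*memory (A (ℕ.suc n) (ℕ.suc K)) (ℕ.>-nonZero⁻¹ K) 0≤ε 3≤εK
        (competitive (ℕ.suc n) (ℕ.suc K))
        -- `kept` comes from the run on the cardinality function, so the memory bound is invoked on
        -- that input.
        (λ ω → ℕ.≤-trans (∣stored∣≤peak (A _ _) _ ω _ others (zero ∷ [])) (memory _ _ (cardinalityInput K) ω))
        Os packed ∣Os∣≡K)
      lemma : ∀ M K → (2 ℕ.* M ℕ.+ 2 ℕ.* M) ℕ.* K ≡ 4 ℕ.* K ℕ.* M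
      lemma = ℕ-Solver.solve-∀

-- Choice of the constants

theoremB1 :
    (ℝ : ArchimedeanOrderedField) →
    let open ArchimedeanOrderedField ℝ
        open Streaming ℝ
    in
    (ε : Carrier) → 0# < ε →
    ∃ λ (k : ℕ) → 1 ℕ.≤ k ×
    (∃ λ (c : Carrier) → 0# < c ×
    (∃ λ (n₀ : ℕ) →
      (A : StreamingAlgorithm) → Competitive (fromℕ 2 - ε) A →
      (m : ℕ → ℕ → ℕ) → UsesMemoryAtMost A m →
      (n : ℕ) → n₀ ℕ.≤ n → c * fromℕ n ≤ fromℕ (m n k)))
-- The constant is c = 1/(4K), with k = K + 1. The threshold K + 1 leaves room for w and one full
-- block.
theoremB1 ℝ ε (0≤ε , 0≉ε) = ℕ.suc K , s≤s z≤n , c , 0<c , ℕ.suc K ,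
  λ A competitive m memory n K<n → begin
    c * fromℕ n                                ≤⟨ *-monoʳ-≤ (proj₁ 0<c) (fromℕ-mono-≤ {n} {4 ℕ.* K ℕ.* m n (ℕ.suc K)}
                                                    (memory-linear K 0≤ε 3≤εK A competitive m memory n K<n)) ⟩
    c * fromℕ (4 ℕ.* K ℕ.* m n (ℕ.suc K))      ≈⟨ *-congˡ (fromℕ-homo-* (4 ℕ.* K) (m n (ℕ.suc K))) ⟩
    c * (d * fromℕ (m n (ℕ.suc K)))            ≈⟨ *-assoc c d _ ⟨
    (c * d) * fromℕ (m n (ℕ.suc K))            ≈⟨ *-congʳ (trans (*-comm c d) dc≈1) ⟩
    1# * fromℕ (m n (ℕ.suc K))                 ≈⟨ *-identityˡ (fromℕ (m n (ℕ.suc K))) ⟩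
    fromℕ (m n (ℕ.suc K))                      ∎
  where
  open ArchimedeanOrderedField ℝ
  open OrderedField ℝ
  open LowerBound ℝ
  open PosetReasoning poset
  ε⁻¹ : ∃ λ y → ε * y ≈ 1#
  ε⁻¹ = inverse ε (0≉ε ∘ sym)
  bound : ∃ λ N → proj₁ ε⁻¹ * fromℕ 3 ≤ fromℕ N
  bound = archimedean (proj₁ ε⁻¹ * fromℕ 3)
  -- The Archimedean bound is at least 3/ε; the successor makes K positive, so that division by K
  -- and by 4K is possible.
  K = ℕ.suc (proj₁ bound)
  3≤εK : fromℕ 3 ≤ ε * fromℕ K
  3≤εK = begin
    fromℕ 3                      ≈⟨ *-identityˡ _ ⟨
    1# * fromℕ 3                 ≈⟨ *-congʳ (proj₂ ε⁻¹) ⟨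
    (ε * proj₁ ε⁻¹) * fromℕ 3    ≈⟨ *-assoc ε _ _ ⟩
    ε * (proj₁ ε⁻¹ * fromℕ 3)    ≤⟨ *-monoʳ-≤ 0≤ε (≤-trans (proj₂ bound)
                                                    (fromℕ-mono-≤ (ℕ.n≤1+n (proj₁ bound)))) ⟩
    ε * fromℕ K                  ∎
  d = fromℕ (4 ℕ.* K)
  d≉0 : ¬ (d ≈ 0#)
  d≉0 d≈0 = contradiction (fromℕ-cancel-≤ {4 ℕ.* K} {0} (≤-reflexive d≈0)) λ ()
  d⁻¹ : ∃ λ y → d * y ≈ 1#
  d⁻¹ = inverse d d≉0
  c = proj₁ d⁻¹
  dc≈1 : d * c ≈ 1#
  dc≈1 = proj₂ d⁻¹
  0<c : 0# < c
  0<c = inverse-positive (0≤fromℕ (4 ℕ.* K)) dc≈1
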